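{- Let $(E,\oplus,0)$ be a PCM whose extension preorder is directed, and let $\mathbb{C}$ be an $E$-graded monoidal category. Then there is a category $\overline{\mathbb{C}}$ with objects $\mathbb{C}_{\mathrm{obj}}$ and hom-sets $$\overline{\mathbb{C}}(X;Y):=\Bigl(\coprod_{a\in E}\mathbb{C}_a(X;Y)\Bigr)/{\equiv},$$ where $\equiv$ is the least equivalence relation generated by the pairs $\langle a,f\rangle\equiv\langle b,f_a^b\rangle$ for every $a\leqslant b$ in $E$.
   Context: **PCMs.** A partial commutative monoid (PCM) $(E,\oplus,0)$ is a set $E$ with a partial function $\oplus:E\times E\rightharpoonup E$ and an element $0\in E$ such that $a\oplus b\simeq b\oplus a$, $a\oplus 0=a=0\oplus a$, $(a\oplus b)\oplus c\simeq a\oplus(b\oplus c)$, where $\simeq$ means: if either side is defined then both are, and they are equal. Write $a\perp b$ when $a\oplus b$ is defined. The extension preorder on $E$ is: $a\leqslant b$ iff there is $c$ with $a\oplus c=b$. It is directed if any two elements have an upper bound. **Graded monoidal categories.** An $E$-graded monoidal category $\mathbb{C}$ consists of: a monoid of objects $(\mathbb{C}_{\mathrm{obj}},\otimes,I)$; for each $a\in E$ a category $\mathbb{C}_a$ with set of objects $\mathbb{C}_{\mathrm{obj}}$, hom-sets $\mathbb{C}_a(X;Y)$, composition written diagrammatically $f\,;_a g$ (subscript often omitted); the identities of $\mathbb{C}_0$ are written $\mathrm{id}_X$; for each $a\leqslant b$ an identity-on-objects functor $(-)_a^b:\mathbb{C}_a\to\mathbb{C}_b$ (regrading); for each $a\perp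 b$ operations $\otimes_{a,b}:\mathbb{C}_a(X;Y)\times\mathbb{C}_b(X';Y')\to\mathbb{C}_{a\oplus b}(X\otimes X';Y\otimes Y')$. Axioms, whenever well typed: $f_a^a=f$ and $(f_a^b)_b^c=f_a^c$; $(f\otimes g)_{a\oplus b}^{c\oplus d}=f_a^c\otimes g_b^d$ for $f\in\mathbb{C}_a$, $g\in\mathbb{C}_b$; $f\otimes\mathrm{id}_I=f=\mathrm{id}_I\otimes f$ and $(f\otimes g)\otimes h=f\otimes(g\otimes h)$; $\mathrm{id}_X\otimes\mathrm{id}_Y=\mathrm{id}_{X\otimes Y}$; $(f\otimes g);(h\otimes k)=(f;h)\otimes(g;k)$ for $f\in\mathbb{C}_a(X;Y)$, $h\in\mathbb{C}_a(Y;Z)$, $g\in\mathbb{C}_b(X';Y')$, $k\in\mathbb{C}_b(Y';Z')$. Write $\langle a,f\rangle$ for $f\in\mathbb{C}_a(X;Y)$ regarded as an element of the coproduct. -}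

module Defs where

open import Level using (Level; suc; _⊔_)
open import Algebra.Structures using (IsMonoid)
open import Data.Product using (Σ-syntax; ∃-syntax; _×_; _,_)
open import Function.Bundles using (_⇔_)
open import Relation.Binary.Bundles using (Setoid)
open import Relation.Binary.Core using (Rel)
open import Relation.Binary.PropositionalEquality using (_≡_; refl)
import Relation.Binary.Construct.Closure.Equivalence as EqClosure

private
  variable
    d e o h r : Level

------------------------------------------------------------------------
-- Partial commutative monoids

-- A partial element of A.  Definedness is an arbitrary proposition, not
-- assumed decidable (as it would be with Maybe); the value does not
-- depend on the proof of definedness.
record Partial (A : Set e) (d : Level) : Set (e ⊔ suc d) where
  field
    Defined : Set d
    value   : Defined → A
    unique  : ∀ p q → value p ≡ value q

open Partial public

module _ {A : Set e} where

  _⇓_ : Partial A d → A → Set (e ⊔ d)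
  x ⇓ a = Σ[ p ∈ Defined x ] value x p ≡ a

  -- Kleene equality.
  _≃_ : Rel (Partial A d) (e ⊔ d)
  x ≃ y = (Defined x ⇔ Defined y) × (∀ p q → value x p ≡ value y q)

  _>>=_ : Partial A d → (A → Partial A d) → Partial A d
  Defined (x >>= f)                 = Σ[ p ∈ Defined x ] Defined (f (value x p))
  value   (x >>= f) (p , q)         = value (f (value x p)) q
  unique  (x >>= f) (p , q) (p′ , q′) with value x p | value x p′ | unique x p p′
  ... | a | .a | refl = unique (f a) q q′

record PCM (e d : Level) : Set (suc (e ⊔ d)) where
  infixl 6 _⊕_
  infix  4 _⊥_ _≤_
  field
    Carrier   : Set e
    _⊕_       : Carrier → Carrier → Partial Carrier d
    𝟘         : Carrier
    comm      : ∀ a b → (a ⊕ b) ≃ (b ⊕ a)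
    identityʳ : ∀ a → (a ⊕ 𝟘) ⇓ a
    identityˡ : ∀ a → (𝟘 ⊕ a) ⇓ a
    assoc     : ∀ a b c → ((a ⊕ b) >>= (_⊕ c)) ≃ ((b ⊕ c) >>= (a ⊕_))

  _⊥_ : Rel Carrier d
  a ⊥ b = Defined (a ⊕ b)

  _≤_ : Rel Carrier (e ⊔ d)
  a ≤ b = ∃[ c ] (a ⊕ c) ⇓ b

  sum : ∀ {a b} → a ⊥ b → Carrier
  sum {a} {b} = value (a ⊕ b)

Directed : {A : Set e} → Rel A r → Set (e ⊔ r)
Directed _≤_ = ∀ a b → ∃[ c ] (a ≤ c) × (b ≤ c)

------------------------------------------------------------------------
-- Categories

-- Hom-sets are setoids, as quotients are not available as types; objects
-- form a type with propositional equality.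
HomFamily : Set o → (h r : Level) → Set (o ⊔ suc (h ⊔ r))
HomFamily Obj h r = Obj → Obj → Setoid h r

-- The structure of a category with given objects and given hom-sets.
-- Composition is in diagrammatic order.
record CategoryOn {Obj : Set o} (𝓗 : HomFamily Obj h r) : Set (o ⊔ h ⊔ r) where
  infixl 7 _⨾_
  infix  4 _≈_

  Hom : Obj → Obj → Set h
  Hom X Y = Setoid.Carrier (𝓗 X Y)

  _≈_ : ∀ {X Y} → Rel (Hom X Y) r
  _≈_ {X} {Y} = Setoid._≈_ (𝓗 X Y)

  field
    ident     : ∀ X → Hom X X
    _⨾_       : ∀ {X Y Z} → Hom X Y → Hom Y Z → Hom X Z
    ⨾-cong    : ∀ {X Y Z} {f f′ : Hom X Y} {g g′ : Hom Y Z} →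
                f ≈ f′ → g ≈ g′ → f ⨾ g ≈ f′ ⨾ g′
    identityˡ : ∀ {X Y} (f : Hom X Y) → ident X ⨾ f ≈ f
    identityʳ : ∀ {X Y} (f : Hom X Y) → f ⨾ ident Y ≈ f
    assoc     : ∀ {W X Y Z} (f : Hom W X) (g : Hom X Y) (k : Hom Y Z) →
                (f ⨾ g) ⨾ k ≈ f ⨾ (g ⨾ k)

record IdentityOnObjectsFunctor
         {Obj : Set o} {𝓗 𝓚 : HomFamily Obj h r}
         (C : CategoryOn 𝓗) (D : CategoryOn 𝓚) : Set (o ⊔ h ⊔ r) where
  private
    module C = CategoryOn C
    module D = CategoryOn D
  field
    map       : ∀ {X Y} → C.Hom X Y → D.Hom X Y
    map-cong  : ∀ {X Y} {f g : C.Hom X Y} → f C.≈ g → map f D.≈ map g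
    map-ident : ∀ X → map (C.ident X) D.≈ D.ident X
    map-⨾     : ∀ {X Y Z} (f : C.Hom X Y) (g : C.Hom Y Z) →
                map (f C.⨾ g) D.≈ map f D.⨾ map g

------------------------------------------------------------------------
-- Graded monoidal categories

-- The laws below hold for all proofs of the side conditions on grades.
-- The first two thus make regrade independent of the proof of a ≤ b, and
-- regrade-⊗ makes _⊗[_]_ independent of the proof of a ⊥ b.

record GradedCategory (E : PCM e d) (Obj : Set o) (h r : Level)
         : Set (e ⊔ d ⊔ o ⊔ suc (h ⊔ r)) where
  open PCM E using (𝟘; _≤_) renaming (Carrier to Grade)

  infixl 7 _⨾_
  infix  4 _≈_ _≋_

  field
    HomSetoid      : Grade → HomFamily Obj h r
    category       : ∀ a → CategoryOn (HomSetoid a)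
    regradeFunctor : ∀ {a b} → a ≤ b →
                     IdentityOnObjectsFunctor (category a) (category b)

  Hom : Grade → Obj → Obj → Set h
  Hom a = CategoryOn.Hom (category a)

  _≈_ : ∀ {a X Y} → Rel (Hom a X Y) r
  _≈_ {a} = CategoryOn._≈_ (category a)

  _⨾_ : ∀ {a X Y Z} → Hom a X Y → Hom a Y Z → Hom a X Z
  _⨾_ {a} = CategoryOn._⨾_ (category a)

  id₀ : ∀ X → Hom 𝟘 X X
  id₀ = CategoryOn.ident (category 𝟘)

  regrade : ∀ {a b X Y} → a ≤ b → Hom a X Y → Hom b X Y
  regrade p = IdentityOnObjectsFunctor.map (regradeFunctor p)

  field
    regrade-refl  : ∀ {a X Y} (p : a ≤ a) (f : Hom a X Y) → regrade p f ≈ f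
    regrade-trans : ∀ {a b c X Y} (p : a ≤ b) (q : b ≤ c) (s : a ≤ c) (f : Hom a X Y) →
                    regrade q (regrade p f) ≈ regrade s f

  -- Equality of morphisms whose grades and endpoints are equal, but
  -- perhaps not definitionally so.
  data _≋_ {a X Y} (f : Hom a X Y) : ∀ {b X′ Y′} → Hom b X′ Y′ → Set (e ⊔ o ⊔ h ⊔ r) where
    ≈⇒≋ : {g : Hom a X Y} → f ≈ g → f ≋ g

record GradedMonoidalCategory (E : PCM e d) (o h r : Level)
         : Set (e ⊔ d ⊔ suc (o ⊔ h ⊔ r)) where
  open PCM E using (𝟘; _⊥_; _≤_; sum)

  infixr 8 _⊗₀_ _⊗[_]_

  field
    Obj            : Set o
    _⊗₀_           : Obj → Obj → Obj
    I              : Obj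
    ⊗₀-isMonoid    : IsMonoid _≡_ _⊗₀_ I
    gradedCategory : GradedCategory E Obj h r

  open GradedCategory gradedCategory public

  field
    _⊗[_]_ : ∀ {a b X Y X′ Y′} →
             Hom a X Y → (p : a ⊥ b) → Hom b X′ Y′ →
             Hom (sum p) (X ⊗₀ X′) (Y ⊗₀ Y′)
    ⊗-cong : ∀ {a b X Y X′ Y′} {f f′ : Hom a X Y} {g g′ : Hom b X′ Y′} (p : a ⊥ b) →
             f ≈ f′ → g ≈ g′ → f ⊗[ p ] g ≈ f′ ⊗[ p ] g′

    regrade-⊗   : ∀ {a b c d X Y X′ Y′} (p : a ⊥ b) (q : c ⊥ d)
                  (s : sum p ≤ sum q) (t : a ≤ c) (u : b ≤ d)
                  (f : Hom a X Y) (g : Hom b X′ Y′) →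
                  regrade s (f ⊗[ p ] g) ≈ regrade t f ⊗[ q ] regrade u g

    ⊗-identityʳ : ∀ {a X Y} (p : a ⊥ 𝟘) (f : Hom a X Y) → f ⊗[ p ] id₀ I ≋ f
    ⊗-identityˡ : ∀ {a X Y} (p : 𝟘 ⊥ a) (f : Hom a X Y) → id₀ I ⊗[ p ] f ≋ f
    ⊗-assoc     : ∀ {a b c X Y X′ Y′ X″ Y″}
                  (p : a ⊥ b) (q : sum p ⊥ c) (s : b ⊥ c) (t : a ⊥ sum s)
                  (f : Hom a X Y) (g : Hom b X′ Y′) (k : Hom c X″ Y″) →
                  (f ⊗[ p ] g) ⊗[ q ] k ≋ f ⊗[ t ] (g ⊗[ s ] k)
    ⊗-id₀       : ∀ X Y (p : 𝟘 ⊥ 𝟘) → id₀ X ⊗[ p ] id₀ Y ≋ id₀ (X ⊗₀ Y)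
    interchange : ∀ {a b X Y Z X′ Y′ Z′} (p : a ⊥ b)
                  (f : Hom a X Y) (g : Hom b X′ Y′) (k : Hom a Y Z) (l : Hom b Y′ Z′) →
                  (f ⊗[ p ] g) ⨾ (k ⊗[ p ] l) ≈ (f ⨾ k) ⊗[ p ] (g ⨾ l)

------------------------------------------------------------------------
-- The hom-sets (∐ₐ ℂₐ(X;Y)) / ≡

module _ {E : PCM e d} (ℂ : GradedMonoidalCategory E o h r) where
  open PCM E using (_≤_) renaming (Carrier to Grade)
  open GradedMonoidalCategory ℂ

  Coproduct : Obj → Obj → Set (e ⊔ h)
  Coproduct X Y = Σ[ a ∈ Grade ] Hom a X Y

  -- ⟨ a , f ⟩ ↝ ⟨ b , f_a^b ⟩.  The second component need only be equal
  -- to f_a^b in the hom-setoid of ℂ_b, so (taking b = a) the generated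
  -- equivalence contains the equality of each ℂ_a.
  data _↝_ {X Y} : Rel (Coproduct X Y) (e ⊔ d ⊔ h ⊔ r) where
    regrades : ∀ {a b} {f : Hom a X Y} {g : Hom b X Y} (p : a ≤ b) →
               regrade p f ≈ g → (a , f) ↝ (b , g)

  QuotientHom : HomFamily Obj (e ⊔ h) (e ⊔ d ⊔ h ⊔ r)
  QuotientHom X Y = EqClosure.setoid (_↝_ {X} {Y})

{-# OPTIONS --safe #-}
module Submission where

-- Directedness makes ≡ concrete: ⟨ a , f ⟩ ≡ ⟨ b , g ⟩ iff f and g become equal
-- after regrading to a common upper bound of a and b.  Morphisms are composed
-- at an upper bound of their grades; any two choices of upper bound agree at a
-- third one, so the laws can be checked inside a single category ℂ_c.

open import Defs
open import Level using (Level; _⊔_)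
open import Data.Product using (Σ-syntax; ∃-syntax; _,_; proj₁; proj₂)
open import Function.Bundles using (Equivalence)
open import Relation.Binary.Bundles using (Setoid)
open import Relation.Binary.Core using (Rel)
open import Relation.Binary.Definitions using (Reflexive; Transitive; Minimum)
open import Relation.Binary.PropositionalEquality as ≡ using (refl)
open import Relation.Binary.Structures using (IsEquivalence)
import Relation.Binary.Construct.Closure.Equivalence as EqClosure
import Relation.Binary.Reasoning.Setoid as SetoidReasoning

module _ {e d : Level} (E : PCM e d) where
  open PCM E

  ≤-refl : Reflexive _≤_
  ≤-refl {a} = 𝟘 , PCM.identityʳ E a

  -- The difference is `x ⊕ y`: associativity yields its definedness and that of `a ⊕ (x ⊕ y)` from
  -- `(a ⊕ x) ⊕ y`.
  ≤-trans : Transitive _≤_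
  ≤-trans {a} (x , p , refl) (y , q , refl) =
    sum (proj₁ st) , proj₂ st , ≡.sym (proj₂ (assoc a x y) (p , q) st)
    where st = Equivalence.to (proj₁ (assoc a x y)) (p , q)

  𝟘-minimum : Minimum _≤_ 𝟘
  𝟘-minimum a = a , PCM.identityˡ E a

module Quotient {e d o h r : Level} (E : PCM e d) (directed : Directed (PCM._≤_ E))
                (ℂ : GradedMonoidalCategory E o h r) where
  open PCM E using (𝟘; _≤_) renaming (Carrier to Grade)
  open GradedMonoidalCategory ℂ

  private
    variable
      a b c : Grade
      W X Y Z : Obj

    module ℂ (a : Grade) = CategoryOn (category a)
    module Regrade {a b : Grade} (p : a ≤ b) = IdentityOnObjectsFunctor (regradeFunctor p)
    module ≈ {a X Y} = Setoid (HomSetoid a X Y)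
    module ≡ᶜ {X Y} = Setoid (QuotientHom ℂ X Y)
    module ≈-Reasoning {a X Y} = SetoidReasoning (HomSetoid a X Y)
    module ≡ᶜ-Reasoning {X Y} = SetoidReasoning (QuotientHom ℂ X Y)

    _≡ᶜ_ : Rel (Coproduct ℂ X Y) _
    _≡ᶜ_ = ≡ᶜ._≈_

  _∼_ : Rel (Coproduct ℂ X Y) (e ⊔ d ⊔ r)
  (a , f) ∼ (b , g) = ∃[ c ] Σ[ p ∈ a ≤ c ] Σ[ q ∈ b ≤ c ] regrade p f ≈ regrade q g

  -- An equality seen at one upper bound persists at every larger one. The proofs `t` and `u` may be
  -- arbitrary because `regrade-trans` holds for any proof of the composite inequality.
  regrade-∼ : {p : a ≤ c} {q : b ≤ c} {f : Hom a X Y} {g : Hom b X Y} → regrade p f ≈ regrade q g →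
              ∀ {w} (s : c ≤ w) (t : a ≤ w) (u : b ≤ w) → regrade t f ≈ regrade u g
  regrade-∼ {p = p} {q} {f} {g} f≈g s t u = begin
    regrade t f              ≈⟨ regrade-trans p s t f ⟨
    regrade s (regrade p f)  ≈⟨ Regrade.map-cong s f≈g ⟩
    regrade s (regrade q g)  ≈⟨ regrade-trans q s u g ⟩
    regrade u g              ∎
    where open ≈-Reasoning

  ∼-isEquivalence : IsEquivalence (_∼_ {X} {Y})
  ∼-isEquivalence = record
    { refl  = _ , ≤-refl E , ≤-refl E , ≈.refl
    ; sym   = λ (c , p , q , f≈g) → c , q , p , ≈.sym f≈g
    ; trans = λ (c , p , q , f≈g) (c′ , p′ , q′ , g≈k) →
        let w , s , s′ = directed c c′
            t = ≤-trans E p s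
            -- Built from the first pair only, `u` also serves for the second, so both equalities
            -- meet in `regrade u g`.
            u = ≤-trans E q s
            v = ≤-trans E q′ s′
        in w , t , v , ≈.trans (regrade-∼ f≈g s t u) (regrade-∼ g≈k s′ u v)
    }

  ↝⇒∼ : {x y : Coproduct ℂ X Y} → _↝_ ℂ x y → x ∼ y
  ↝⇒∼ (regrades p f≈g) = _ , p , ≤-refl E , ≈.trans f≈g (≈.sym (regrade-refl (≤-refl E) _))

  -- A zigzag of regradings of any length collapses to a single equation, by minimality of the
  -- generated equivalence.
  ≡ᶜ⇒∼ : {x y : Coproduct ℂ X Y} → x ≡ᶜ y → x ∼ y
  ≡ᶜ⇒∼ = EqClosure.fold ∼-isEquivalence ↝⇒∼

  ≡ᶜ-regrade : (p : a ≤ b) (f : Hom a X Y) → (a , f) ≡ᶜ (b , regrade p f)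
  ≡ᶜ-regrade p f = EqClosure.return (regrades p ≈.refl)

  ∼⇒≡ᶜ : {x y : Coproduct ℂ X Y} → x ∼ y → x ≡ᶜ y
  ∼⇒≡ᶜ (c , p , q , f≈g) =
    ≡ᶜ.trans (EqClosure.return (regrades p f≈g)) (≡ᶜ.sym (≡ᶜ-regrade q _))

  ≈⇒≡ᶜ : {f g : Hom a X Y} → f ≈ g → (a , f) ≡ᶜ (a , g)
  ≈⇒≡ᶜ f≈g = EqClosure.return (regrades (≤-refl E) (≈.trans (regrade-refl (≤-refl E) _) f≈g))

  regrade-⨾ : (p : a ≤ c) (q : b ≤ c) {w : Grade} (s : c ≤ w) (t : a ≤ w) (u : b ≤ w)
              (f : Hom a X Y) (g : Hom b Y Z) →
              regrade s (regrade p f ⨾ regrade q g) ≈ regrade t f ⨾ regrade u g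
  regrade-⨾ p q s t u f g =
    ≈.trans (Regrade.map-⨾ s _ _) (ℂ.⨾-cong _ (regrade-trans p s t f) (regrade-trans q s u g))

  infixl 7 _⨟_
  _⨟_ : Coproduct ℂ X Y → Coproduct ℂ Y Z → Coproduct ℂ X Z
  (a , f) ⨟ (b , g) = let c , p , q = directed a b in c , regrade p f ⨾ regrade q g

  -- Composition does not depend on the bound that `directed` picks: regrading is functorial, so
  -- both composites become `regrade t f ⨾ regrade u g` at `w`.
  ⨟-at : (p : a ≤ c) (q : b ≤ c) (f : Hom a X Y) (g : Hom b Y Z) →
         ((a , f) ⨟ (b , g)) ≡ᶜ (c , regrade p f ⨾ regrade q g)
  ⨟-at {a} {c} {b} p q f g =
    let c′ , p′ , q′ = directed a b
        w , s , s′   = directed c c′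
        t = ≤-trans E p s
        u = ≤-trans E q s
    in ∼⇒≡ᶜ (w , s′ , s , ≈.trans (regrade-⨾ p′ q′ s′ t u f g) (≈.sym (regrade-⨾ p q s t u f g)))

  ⨟-cong : {x x′ : Coproduct ℂ X Y} {y y′ : Coproduct ℂ Y Z} → x ≡ᶜ x′ → y ≡ᶜ y′ → (x ⨟ y) ≡ᶜ (x′ ⨟ y′)
  ⨟-cong {x = a , f} {a′ , f′} {b , g} {b′ , g′} x≡x′ y≡y′ =
    let c , p , p′ , f≈f′ = ≡ᶜ⇒∼ x≡x′
        k , q , q′ , g≈g′ = ≡ᶜ⇒∼ y≡y′
        -- The two hypotheses hold at unrelated bounds `c` and `k`; at `w` both hold in one
        -- category.
        w , s , s′        = directed c k
        t  = ≤-trans E p s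
        t′ = ≤-trans E p′ s
        u  = ≤-trans E q s′
        u′ = ≤-trans E q′ s′
    in begin
      (a , f) ⨟ (b , g)                    ≈⟨ ⨟-at t u f g ⟩
      (w , regrade t f ⨾ regrade u g)      ≈⟨ ≈⇒≡ᶜ (ℂ.⨾-cong w (regrade-∼ f≈f′ s t t′)
                                                               (regrade-∼ g≈g′ s′ u u′)) ⟩
      (w , regrade t′ f′ ⨾ regrade u′ g′)  ≈⟨ ⨟-at t′ u′ f′ g′ ⟨
      (a′ , f′) ⨟ (b′ , g′)                ∎
    where open ≡ᶜ-Reasoning

  -- With `⨟-cong`, this determines composition up to `≡ᶜ`, since any two morphisms can be regraded
  -- to a common grade.
  ⨟-sameGrade : (f : Hom a X Y) (g : Hom a Y Z) → ((a , f) ⨟ (a , g)) ≡ᶜ (a , f ⨾ g)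
  ⨟-sameGrade {a} f g = ≡ᶜ.trans (⨟-at (≤-refl E) (≤-refl E) f g)
    (≈⇒≡ᶜ (ℂ.⨾-cong a (regrade-refl (≤-refl E) f) (regrade-refl (≤-refl E) g)))

  -- Since `𝟘` is least and regrading preserves identities, the unit laws for a morphism of grade
  -- `a` reduce to those of the category at `a`.
  id₀≡ᶜident : ∀ a X → (𝟘 , id₀ X) ≡ᶜ (a , ℂ.ident a X)
  id₀≡ᶜident a X = EqClosure.return (regrades 0≤a (Regrade.map-ident 0≤a X))
    where 0≤a = 𝟘-minimum E a

  ⨟-identityˡ : (x : Coproduct ℂ X Y) → ((𝟘 , id₀ X) ⨟ x) ≡ᶜ x
  ⨟-identityˡ {X} (a , f) = begin
    (𝟘 , id₀ X) ⨟ (a , f)          ≈⟨ ⨟-cong (id₀≡ᶜident a X) ≡ᶜ.refl ⟩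
    (a , ℂ.ident a X) ⨟ (a , f)    ≈⟨ ⨟-sameGrade (ℂ.ident a X) f ⟩
    (a , ℂ.ident a X ⨾ f)          ≈⟨ ≈⇒≡ᶜ (ℂ.identityˡ a f) ⟩
    (a , f)                        ∎
    where open ≡ᶜ-Reasoning

  ⨟-identityʳ : (x : Coproduct ℂ X Y) → (x ⨟ (𝟘 , id₀ Y)) ≡ᶜ x
  ⨟-identityʳ {Y = Y} (a , f) = begin
    (a , f) ⨟ (𝟘 , id₀ Y)          ≈⟨ ⨟-cong ≡ᶜ.refl (id₀≡ᶜident a Y) ⟩
    (a , f) ⨟ (a , ℂ.ident a Y)    ≈⟨ ⨟-sameGrade f (ℂ.ident a Y) ⟩
    (a , f ⨾ ℂ.ident a Y)          ≈⟨ ≈⇒≡ᶜ (ℂ.identityʳ a f) ⟩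
    (a , f)                        ∎
    where open ≡ᶜ-Reasoning

  ⨟-assoc : (x : Coproduct ℂ W X) (y : Coproduct ℂ X Y) (z : Coproduct ℂ Y Z) →
            ((x ⨟ y) ⨟ z) ≡ᶜ (x ⨟ (y ⨟ z))
  ⨟-assoc x@(a , f) y@(b , g) z@(c , k) =
    let ab , a≤ab , b≤ab = directed a b
        -- `w` bounds all three grades, so each factor can be replaced by a representative of grade
        -- `w`.
        w , ab≤w , c≤w   = directed ab c
        f′ = regrade (≤-trans E a≤ab ab≤w) f
        g′ = regrade (≤-trans E b≤ab ab≤w) g
        k′ = regrade c≤w k
        x≡f′ = ≡ᶜ-regrade (≤-trans E a≤ab ab≤w) f
        y≡g′ = ≡ᶜ-regrade (≤-trans E b≤ab ab≤w) g
        z≡k′ = ≡ᶜ-regrade c≤w k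
    in begin
      (x ⨟ y) ⨟ z                        ≈⟨ ⨟-cong (⨟-cong x≡f′ y≡g′) z≡k′ ⟩
      ((w , f′) ⨟ (w , g′)) ⨟ (w , k′)   ≈⟨ ⨟-cong (⨟-sameGrade f′ g′) ≡ᶜ.refl ⟩
      (w , f′ ⨾ g′) ⨟ (w , k′)           ≈⟨ ⨟-sameGrade (f′ ⨾ g′) k′ ⟩
      (w , (f′ ⨾ g′) ⨾ k′)               ≈⟨ ≈⇒≡ᶜ (ℂ.assoc w f′ g′ k′) ⟩
      (w , f′ ⨾ (g′ ⨾ k′))               ≈⟨ ⨟-sameGrade f′ (g′ ⨾ k′) ⟨
      (w , f′) ⨟ (w , g′ ⨾ k′)           ≈⟨ ⨟-cong ≡ᶜ.refl (⨟-sameGrade g′ k′) ⟨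
      (w , f′) ⨟ ((w , g′) ⨟ (w , k′))   ≈⟨ ⨟-cong x≡f′ (⨟-cong y≡g′ z≡k′) ⟨
      x ⨟ (y ⨟ z)                        ∎
    where open ≡ᶜ-Reasoning

proposition5p6 : ∀ {e d o h r : Level} (E : PCM e d) → Directed (PCM._≤_ E) →
    (ℂ : GradedMonoidalCategory E o h r) →
    let open GradedMonoidalCategory ℂ in
    Σ[ C ∈ CategoryOn (QuotientHom ℂ) ]
    (∀ {a X Y Z} (f : Hom a X Y) (g : Hom a Y Z) →
    CategoryOn._≈_ C (CategoryOn._⨾_ C (a , f) (a , g)) (a , f ⨾ g))
proposition5p6 E directed ℂ = record
  { ident     = λ X → PCM.𝟘 E , GradedMonoidalCategory.id₀ ℂ X
  ; _⨾_       = _⨟_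
  ; ⨾-cong    = ⨟-cong
  ; identityˡ = ⨟-identityˡ
  ; identityʳ = ⨟-identityʳ
  ; assoc     = ⨟-assoc
  } , ⨟-sameGrade
  where open Quotient E directed ℂ
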